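{- Let $M\geq 1$ be an integer and let $(\tau^\prime,R)$ be an $M$-layer medium for transmission, with $\tau^\prime=(\tau_0,\ldots,\tau_{M+1})$, $\tau=(\tau_0,\ldots,\tau_M)$, $R=(R_0,\ldots,R_M)$, and write $|\tau^\prime|=\tau_0+\cdots+\tau_{M+1}$. Then \[ H^{(\tau^\prime,R)}(t)=\sum_{k\in\{0\}\times\mathbb{Z}^M_+}b(R,k)\,\delta\bigl(t-\tfrac{1}{2}|\tau^\prime|-\langle k,\tau\rangle\bigr), \] where for each $k\in\{0\}\times\mathbb{Z}^M_+$, \[ b(R,k)=\sum_{0\leq m\leq\min\{k,\tilde{k}\}}\binom{k}{m}\binom{\tilde{k}}{m}(-R)^{\tilde{k}-m}R^{k-m}T^{2m+\mathbb{1}}, \] the sum being over $m\in\mathbb{Z}^{M+1}$.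
   Context: Fix depths $z_{ -1}<z_0<\cdots<z_M<z_{M+1}$. The medium consists of positive reals $\tau^\prime=(\tau_0,\ldots,\tau_{M+1})$ ($\tau_j/2$ is the time to traverse between $z_{j-1}$ and $z_j$) and reals $R=(R_0,\ldots,R_M)$ with $-1<R_n<1$; $T_n=\sqrt{1-R_n^2}$, $T=(T_0,\ldots,T_M)$. $\mathbb{Z}_+$ denotes the nonnegative integers. A transmission scattering sequence is a finite sequence $\mathsf{p}=(\mathsf{p}_0,\ldots,\mathsf{p}_L)$ with $\mathsf{p}_0=z_{ -1}$, $\mathsf{p}_L=z_{M+1}$, $\mathsf{p}_i\in\{z_0,\ldots,z_M\}$ for $1\le i\le L-1$, and for every $0\le i\le L-1$ there is $-1\le j\le M$ with $\{\mathsf{p}_i,\mathsf{p}_{i+1}\}=\{z_j,z_{j+1}\}$. Its weight is $w(\mathsf{p})=\prod_{i=1}^{L-1}w_i$, where if $\mathsf{p}_i=z_j$: $w_i=R_j$ if $\mathsf{p}_{i-1}=\mathsf{p}_{i+1}=z_{j-1}$; $w_i=-R_j$ if $\mathsf{p}_{i-1}=\mathsf{p}_{i+1}=z_{j+1}$; $w_i=T_j$ otherwise. Its arrival time is $\sigma(\mathsf{p})=\sum_{i=0}^{L-1}\tau_{j_i}/2$ where step $i$ goes between $z_{j_i-1}$ and $z_{j_i}$ ($0\le j_i\le M+1$). The transmission Green's function (velocity impulse response recorded at $z_{M+1}$ for a downward unit plane-wave impulse started at $z_{ -1}$) is $H^{(\tau^\prime,R)}(t)=\sum_{\mathsf{p}}w(\mathsf{p})\delta(t-\sigma(\mathsf{p}))$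 over all transmission scattering sequences, terms with equal arrival times combined. Vector conventions: $\tilde{k}=(k_1,\ldots,k_M,0)$; $\mathbb{1}=(1,\ldots,1)$; $\min$ and $\le$ entrywise; $\langle k,\tau\rangle=\sum_{n=0}^M k_n\tau_n$; $s^d=\prod_n s_n^{d_n}$ (with $0^0=1$); $\binom{x}{y}=\prod_n\binom{x_n}{y_n}$. -}

module Defs where

open import Level using (Level; _⊔_) renaming (suc to lsuc)
open import Algebra.Apartness.Bundles using (HeytingField; HeytingCommutativeRing)
open import Algebra.Bundles using (CommutativeRing; Semiring)
import Algebra.Definitions.RawMonoid as RawMonoidDefs
import Algebra.Definitions.RawSemiring as RawSemiringDefs
open import Data.Bool.Base using (if_then_else_)
open import Data.Fin.Base using (Fin; zero; suc; inject₁; fromℕ)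
open import Data.Fin.Properties using (_≟_)
open import Data.List.Base as List using (List; []; _∷_; upTo; cartesianProductWith)
open import Data.List.Membership.Propositional using (_∉_)
open import Data.List.Relation.Unary.Linked using (Linked; []; [-]; _∷_)
open import Data.List.Relation.Unary.Unique.Propositional using (Unique)
open import Data.Nat.Base as ℕ using (ℕ; zero; suc)
open import Data.Nat.Combinatorics using (_C_)
open import Data.Product.Base using (∃; ∃-syntax; _×_; _,_; proj₁)
open import Data.Sum.Base using (_⊎_; inj₁; inj₂)
open import Data.Vec.Base as Vec using (Vec; []; _∷_)
open import Data.Vec.Functional using (Vector)
open import Function.Bundles using (_⇔_; Equivalence)
open import Relation.Binary.Core using (Rel)
open import Relation.Binary.PropositionalEquality.Core using (_≡_)
open import Relation.Binary.Structures using (IsStrictPartialOrder)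
open import Relation.Nullary.Decidable using (⌊_⌋; _×-dec_)
open import Relation.Nullary.Negation using (¬_)

------------------------------------------------------------------------
-- The real numbers

-- The axioms of a Cauchy-complete Archimedean ordered field, in the form
-- valid constructively; classically they determine ℝ up to isomorphism.
-- The square root is determined by the other data and is included as an
-- operation only for convenience; its values at negative arguments are
-- unspecified.
record RealField (c ℓ₁ ℓ₂ : Level) : Set (lsuc (c ⊔ ℓ₁ ⊔ ℓ₂)) where
  field
    heytingField : HeytingField c ℓ₁ ℓ₂

  open HeytingField heytingField public

  commutativeRing : CommutativeRing c ℓ₁
  commutativeRing = HeytingCommutativeRing.commutativeRing heytingCommutativeRing

  open CommutativeRing commutativeRing public
    using (semiring)
  open Semiring semiring public
    using (rawSemiring; +-rawMonoid; *-rawMonoid)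
  open RawSemiringDefs rawSemiring public using (_^_)
  open RawMonoidDefs +-rawMonoid public
    using () renaming (_×_ to _·_; sum to ∑)
  open RawMonoidDefs *-rawMonoid public
    using () renaming (sum to ∏)

  infix 4 _<_ _≤_

  field
    _<_                  : Rel Carrier ℓ₂
    isStrictPartialOrder : IsStrictPartialOrder _≈_ _<_
    #⇔<⊎>                : ∀ {x y} → (x # y) ⇔ (x < y ⊎ y < x)
    0<1                  : 0# < 1#
    +-monoʳ-<            : ∀ z {x y} → x < y → z + x < z + y
    *-pos                : ∀ {x y} → 0# < x → 0# < y → 0# < x * y

  _≤_ : Rel Carrier ℓ₂
  x ≤ y = ¬ (y < x)

  ∣_-_∣<_ : Carrier → Carrier → Carrier → Set ℓ₂
  ∣ x - y ∣< ε = (x + - y < ε) × (y + - x < ε)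

  field
    archimedean : ∀ x → ∃[ n ] x < n · 1#
    complete    : (s : ℕ → Carrier) →
                  (∀ ε → 0# < ε → ∃[ N ] (∀ m n → N ℕ.≤ m → N ℕ.≤ n → ∣ s m - s n ∣< ε)) →
                  ∃[ l ] (∀ ε → 0# < ε → ∃[ N ] (∀ n → N ℕ.≤ n → ∣ s n - l ∣< ε))
    √           : Carrier → Carrier
    √-nonneg    : ∀ {x} → 0# ≤ x → 0# ≤ √ x
    √-square    : ∀ {x} → 0# ≤ x → √ x * √ x ≈ x

  open IsStrictPartialOrder isStrictPartialOrder public
    using (<-resp-≈; <-respʳ-≈; <-respˡ-≈)
    renaming (irrefl to <-irrefl; trans to <-trans; asym to <-asym)

  2# : Carrier
  2# = 1# + 1#

  2#0 : 2# # 0#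
  2#0 = Equivalence.from #⇔<⊎>
          (inj₂ (<-trans 0<1 (<-respˡ-≈ (+-identityʳ 1#) (+-monoʳ-< 1# 0<1))))

  -- An inverse of 2# - 0#, hence of 2#.
  ½ : Carrier
  ½ = proj₁ (#⇒invertible 2#0)

------------------------------------------------------------------------
-- Depths and scattering sequences

-- The M + 3 depths z₋₁ < z₀ < ⋯ < z_{M+1}; the index is shifted by one, so
-- that z_j is represented by j + 1.
Depth : ℕ → Set
Depth M = Fin (3 ℕ.+ M)

module _ {M : ℕ} where

  source receiver : Depth M
  source   = zero
  receiver = fromℕ (2 ℕ.+ M)

  -- For 0 ≤ n ≤ M: the depths z_n, z_{n-1} and z_{n+1}.
  z above below : Fin (suc M) → Depth M
  z     n = suc (inject₁ n)
  above n = inject₁ (inject₁ n)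
  below n = suc (suc n)

  -- {a , b} = {z_{j-1} , z_j} for some 0 ≤ j ≤ M + 1.
  Adjacent : Rel (Depth M) _
  Adjacent a b = ∃[ j ] ((a ≡ inject₁ j × b ≡ suc j) ⊎ (a ≡ suc j × b ≡ inject₁ j))

  layer : ∀ {a b} → Adjacent a b → Fin (2 ℕ.+ M)
  layer = proj₁

  -- The sequence (p₀ , … , p_L) whose interior (p₁ , … , p_{L-1}) is given.
  fullSequence : List (Fin (suc M)) → List (Depth M)
  fullSequence q = source ∷ (List.map z q List.∷ʳ receiver)

TransmissionSequence : ℕ → Set
TransmissionSequence M = ∃[ q ] Linked Adjacent (fullSequence {M} q)

------------------------------------------------------------------------
-- Multi-indices

-- (k₀ , k₁ , … , k_M) ↦ (k₁ , … , k_M , 0)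
shift : ∀ {M} → Vec ℕ (suc M) → Vec ℕ (suc M)
shift k = Vec.tail k Vec.∷ʳ 0

minᵛ _∸ᵛ_ : ∀ {n} → Vec ℕ n → Vec ℕ n → Vec ℕ n
minᵛ = Vec.zipWith ℕ._⊓_
_∸ᵛ_ = Vec.zipWith ℕ._∸_

2*_+𝟙 : ∀ {n} → Vec ℕ n → Vec ℕ n
2* m +𝟙 = Vec.map (λ mₙ → 2 ℕ.* mₙ ℕ.+ 1) m

binom : ∀ {n} → Vec ℕ n → Vec ℕ n → ℕ
binom x y = Vec.foldr′ ℕ._*_ 1 (Vec.zipWith _C_ x y)

-- Every vector m with 0 ≤ m ≤ u entrywise, listed exactly once.
box : ∀ {n} → Vec ℕ n → List (Vec ℕ n)
box []       = [] ∷ []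
box (u ∷ us) = cartesianProductWith _∷_ (upTo (suc u)) (box us)

------------------------------------------------------------------------

module Scattering {c ℓ₁ ℓ₂} (ℝ : RealField c ℓ₁ ℓ₂) where
  open RealField ℝ

  ∑ˡ : ∀ {i} {I : Set i} → List I → (I → Carrier) → Carrier
  ∑ˡ xs f = List.foldr _+_ 0# (List.map f xs)

  ----------------------------------------------------------------------
  -- Sums of delta functions

  -- The sum of a finitely supported family.
  record _SumsTo_ {I : Set} (f : I → Carrier) (s : Carrier) : Set (c ⊔ ℓ₁) where
    field
      support  : List I
      unique   : Unique support
      vanishes : ∀ i → i ∉ support → f i ≈ 0#
      total    : ∑ˡ support f ≈ s

  -- The formal sum  Σ_{i ∈ Index} amplitude(i) δ(t − time(i)).
  record ImpulseTrain : Set (lsuc Level.zero ⊔ c) where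
    constructor impulses
    field
      Index     : Set
      amplitude : Index → Carrier
      time      : Index → Carrier

  -- Continuity of test functions is not required: δ evaluates any function.
  -- Classically, the test functions thus include the indicator function of
  -- each single time, which reads off the total amplitude arriving then.
  record TestFunction : Set (c ⊔ ℓ₁ ⊔ ℓ₂) where
    field
      φ           : Carrier → Carrier
      φ-cong      : ∀ {s t} → s ≈ t → φ s ≈ φ t
      lower upper : Carrier
      bounded     : ∀ t → t < lower ⊎ upper < t → φ t ≈ 0#

  _⟨_⟩≔_ : ImpulseTrain → TestFunction → Carrier → Set (c ⊔ ℓ₁)
  A ⟨ ψ ⟩≔ s = (λ i → amplitude i * φ (time i)) SumsTo s
    where
    open ImpulseTrain A
    open TestFunction ψ

  -- Equality as distributions. Both sides are required to be locally
  -- finite, so that their pairing with a test function is a finite sum.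
  infix 4 _≐_
  _≐_ : ImpulseTrain → ImpulseTrain → Set (c ⊔ ℓ₁ ⊔ ℓ₂)
  A ≐ B = ∀ ψ → ∃[ s ] (A ⟨ ψ ⟩≔ s) × (B ⟨ ψ ⟩≔ s)

  ----------------------------------------------------------------------
  -- Layered media

  transmission : ∀ {n} → Vector Carrier n → Vector Carrier n
  transmission R n = √ (1# + - (R n * R n))

  record Medium (M : ℕ) : Set (c ⊔ ℓ₂) where
    field
      τ′   : Vector Carrier (2 ℕ.+ M)
      R    : Vector Carrier (suc M)
      τ′>0 : ∀ j → 0# < τ′ j
      -1<R : ∀ n → - 1# < R n
      R<1  : ∀ n → R n < 1#

    τ : Vector Carrier (suc M)
    τ j = τ′ (inject₁ j)

    T : Vector Carrier (suc M)
    T = transmission R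

  module _ {M : ℕ} (μ : Medium M) where
    open Medium μ

    -- The factor of a visit to z_n coming from depth a and going to depth b.
    factor : Depth M → Fin (suc M) → Depth M → Carrier
    factor a n b =
      if ⌊ (a ≟ above n) ×-dec (b ≟ above n) ⌋ then R n else
      if ⌊ (a ≟ below n) ×-dec (b ≟ below n) ⌋ then - R n else
      T n

    -- The depth visited first by the remainder of a sequence.
    next : List (Fin (suc M)) → Depth M
    next []      = receiver
    next (n ∷ _) = z n

    weightFrom : Depth M → List (Fin (suc M)) → Carrier
    weightFrom a []      = 1#
    weightFrom a (n ∷ q) = factor a n (next q) * weightFrom (z n) q

    weight : TransmissionSequence M → Carrier
    weight (q , _) = weightFrom source q

    travelTime : ∀ {p} → Linked Adjacent p → Carrier
    travelTime []       = 0#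
    travelTime [-]      = 0#
    travelTime (e ∷ es) = ½ * τ′ (layer e) + travelTime es

    arrival : TransmissionSequence M → Carrier
    arrival (_ , steps) = travelTime steps

    H : ImpulseTrain
    H = impulses (TransmissionSequence M) weight arrival

  ----------------------------------------------------------------------
  -- The coefficients

  infixr 8 _^ᵛ_
  _^ᵛ_ : ∀ {n} → Vector Carrier n → Vec ℕ n → Carrier
  s ^ᵛ d = ∏ (λ n → s n ^ Vec.lookup d n)

  ⟨_,_⟩ : ∀ {n} → Vec ℕ n → Vector Carrier n → Carrier
  ⟨ k , t ⟩ = ∑ (λ n → Vec.lookup k n · t n)

  b : ∀ {M} → Vector Carrier (suc M) → Vec ℕ (suc M) → Carrier
  b R k = ∑ˡ (box (minᵛ k k̃)) λ m →
    (binom k m ℕ.* binom k̃ m) ·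
      (((λ n → - R n) ^ᵛ (k̃ ∸ᵛ m)) * (R ^ᵛ (k ∸ᵛ m)) * (transmission R ^ᵛ (2* m +𝟙)))
    where k̃ = shift k

module Submission where

-- A scattering sequence is determined by the order of the upward and downward
-- exits from each interface.  Since an exit to one side is followed by an
-- arrival from that side, the weight factors over the interfaces, and the
-- factor of z_n depends only on its word of exits.  With k_n ascents through
-- layer n this word has k_n upward and k_{n+1} + 1 downward exits and ends
-- downward; the sequences with given k are exactly the choices of such words.
-- Summing over the words with m + 1 transmissions downward and m upward gives
-- the n-th factor of b(R, k).  Instead of constructing the bijection, both the
-- total weight of the remaining walks and the product of the remaining word
-- sums are shown to satisfy the same recursion along a single step.
-- The arrival time depends on k only, and by the Archimedean property all
-- but finitely many k arrive after the support of a given test function.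

open import Algebra.Bundles using (CommutativeRing)
open import Axiom.UniquenessOfIdentityProofs.WithK using (uip)
open import Data.Fin.Base using (Fin; zero; suc; inject₁; fromℕ; toℕ)
import Data.Fin.Properties as Fin
open import Data.Fin.Relation.Unary.Top using (view; ‵fromℕ; ‵inject₁)
open import Data.List.Base as List using (List; []; _∷_; _++_; upTo; applyUpTo; cartesianProductWith)
open import Data.List.Membership.Propositional using (_∈_; _∉_)
open import Data.List.Membership.Propositional.Properties
  using (∈-map⁺; ∈-map⁻; ∈-++⁺ˡ; ∈-++⁺ʳ; ∈-++⁻; ∈-upTo⁺; ∈-cartesianProductWith⁺)
import Data.List.Properties as List
open import Data.List.Relation.Unary.All as All using ([]; _∷_)
open import Data.List.Relation.Unary.AllPairs using ([]; _∷_)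
open import Data.List.Relation.Unary.Any using (here; there)
open import Data.List.Relation.Unary.Linked as Linked using (Linked; [-]; _∷_)
open import Data.List.Relation.Unary.Unique.Propositional using (Unique)
import Data.List.Relation.Unary.Unique.Propositional.Properties as Unique
open import Data.Nat.Base using (ℕ) renaming (_≤_ to _≤ℕ_)
open import Data.Nat.Base as ℕ using (zero; suc; s≤s; z≤n; s≤s⁻¹)
open import Data.Nat.Combinatorics using (_C_; nCk+nC[k+1]≡[n+1]C[k+1]; k>n⇒nCk≡0)
import Data.Nat.Properties as ℕ
open import Data.Product.Base using (∃; _×_; _,_; proj₁; proj₂)
open import Data.Sum.Base using (_⊎_; inj₁; inj₂; [_,_])
open import Data.Vec.Base using (Vec; _∷_)
open import Data.Vec.Base as Vec using ([]; replicate; lookup; updateAt; sum)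
open import Data.Vec.Functional using (Vector)
import Data.Vec.Properties as Vec
open import Function.Base using (_∘_; id; case_of_)
open import Function.Bundles using (Equivalence)
open import Level using (_⊔_)
open import Relation.Binary.Definitions using (Irrelevant)
open import Relation.Binary.PropositionalEquality.Core as ≡ using (_≡_; _≢_; refl)
open import Relation.Nullary using (¬_; contradiction; yes; no)
open import Relation.Unary using (_∪_)
open import Defs

-- Depths, adjacency and paths

inject₁²≢suc² : ∀ {n} {j : Fin n} → inject₁ (inject₁ j) ≢ suc (suc j)
inject₁²≢suc² {j = suc j} eq = inject₁²≢suc² (Fin.suc-injective eq)

-- Together the equations would say i = j + 1 and j = i + 1. This excludes that a step is at once
-- downward and upward.
inject₁≡suc⇒suc≢inject₁ : ∀ {n} {i j : Fin n} → inject₁ i ≡ suc j → suc i ≢ inject₁ j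
inject₁≡suc⇒suc≢inject₁ {i = suc i} {j = suc j} eq eq′ =
  inject₁≡suc⇒suc≢inject₁ (Fin.suc-injective eq) (Fin.suc-injective eq′)

module _ {M : ℕ} where

  -- The two depths determine the layer and the direction of a step. Hence a transmission sequence
  -- is determined by its interior alone.
  Adjacent-irrelevant : Irrelevant (Adjacent {M})
  Adjacent-irrelevant (_ , inj₁ (refl , refl)) (_ , inj₁ (refl , refl)) = refl
  Adjacent-irrelevant (_ , inj₂ (refl , refl)) (_ , inj₂ (refl , refl)) = refl
  Adjacent-irrelevant (_ , inj₁ (refl , refl)) (_ , inj₂ (e , e′)) =
    contradiction e′ (inject₁≡suc⇒suc≢inject₁ e)
  Adjacent-irrelevant (_ , inj₂ (refl , refl)) (_ , inj₁ (e , e′)) =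
    contradiction e (inject₁≡suc⇒suc≢inject₁ e′)

  first : List (Fin (suc M)) → Depth M
  first []      = receiver
  first (n ∷ _) = z n

  Path : List (Fin (suc M)) → Set
  Path q = Linked Adjacent (List.map z q List.∷ʳ receiver)

  PathFrom : Depth M → List (Fin (suc M)) → Set
  PathFrom a q = Linked Adjacent (a ∷ (List.map z q List.∷ʳ receiver))

  -- The case distinction on `q` exposes the head of the remaining list to `Linked`.
  prepend : ∀ {a} q → Adjacent a (first q) → Path q → PathFrom a q
  prepend []      e es = e ∷ es
  prepend (n ∷ q) e es = e ∷ es

  split : ∀ {a} q → PathFrom a q → Adjacent a (first q) × Path q
  split []      (e ∷ es) = e , es
  split (n ∷ q) (e ∷ es) = e , es

-- Walks and their correspondence with transmission sequences

-- The continuations of a scattering sequence which has just reached z_p, where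
-- p = M + 1 stands for the receiver.
data Walk {M : ℕ} (p : Fin (2 ℕ.+ M)) : Set where
  arrived : p ≡ fromℕ (suc M) → Walk p
  up      : ∀ j → p ≡ inject₁ (suc j) → Walk (inject₁ (inject₁ j)) → Walk p
  down    : ∀ j → p ≡ inject₁ j → Walk (suc j) → Walk p

module _ {M : ℕ} where

  interior : {p : Fin (2 ℕ.+ M)} → Walk p → List (Fin (suc M))
  interior (arrived _)  = []
  interior (up j _ w)   = suc j ∷ interior w
  interior (down j _ w) = j ∷ interior w

  first-interior : {p : Fin (2 ℕ.+ M)} (w : Walk p) → first (interior w) ≡ suc p
  first-interior (arrived refl)  = refl
  first-interior (up j refl w)   = refl
  first-interior (down j refl w) = refl

  -- The common head is the interface being left; the direction is read off from the next depth,
  -- since an upward and a downward step end two levels apart.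
  interior-injective : {p : Fin (2 ℕ.+ M)} (w w′ : Walk p) → interior w ≡ interior w′ → w ≡ w′
  interior-injective (arrived e)  (arrived e′)  eq = ≡.cong arrived (uip e e′)
  interior-injective (up j e w)   (up j′ e′ w′) eq with List.∷-injective eq
  ... | refl , eq′ = ≡.cong₂ (up j) (uip e e′) (interior-injective w w′ eq′)
  interior-injective (down j e w) (down j′ e′ w′) eq with List.∷-injective eq
  ... | refl , eq′ = ≡.cong₂ (down j) (uip e e′) (interior-injective w w′ eq′)
  interior-injective (up j e w)   (down j′ e′ w′) eq with List.∷-injective eq
  ... | refl , eq′ = contradiction
    (Fin.suc-injective (≡.trans (≡.sym (first-interior w)) (≡.trans (≡.cong first eq′) (first-interior w′))))
    inject₁²≢suc²
  interior-injective (down j e w) (up j′ e′ w′) eq with List.∷-injective eq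
  ... | refl , eq′ = contradiction
    (Fin.suc-injective (≡.trans (≡.sym (first-interior w′)) (≡.trans (≡.cong first (≡.sym eq′)) (first-interior w))))
    inject₁²≢suc²

  path : {p : Fin (2 ℕ.+ M)} (w : Walk p) → Path (interior w)
  path (arrived _)  = [-]
  path (up j _ w)   = prepend (interior w) (inject₁ (suc j) , inj₂ (refl , first-interior w)) (path w)
  path (down j _ w) = prepend (interior w) (suc j , inj₁ (refl , first-interior w)) (path w)

  -- The adjacency witness of the first step decides between `up` and `down`, so every path arises
  -- from a walk.
  walk : ∀ p q → first q ≡ suc p → Path q → ∃ λ (w : Walk p) → interior w ≡ q
  walk p []      refl es = arrived refl , refl
  walk p (n ∷ q) refl es with split q es
  walk p (n ∷ q) refl es | (suc l , inj₁ (e , e′)) , es′ with Fin.inject₁-injective (Fin.suc-injective e)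
  ... | refl with walk (suc n) q e′ es′
  ... | w , refl = down n refl w , refl
  -- An upward step from z_0 would lead back to the source, which is neither an interface nor the
  -- receiver.
  walk p (zero ∷ n ∷ q)  refl es | (_ , inj₂ (refl , ())) , es′
  walk p (suc j ∷ q) refl es | (_ , inj₂ (refl , e′)) , es′ with walk (inject₁ (inject₁ j)) q e′ es′
  ... | w , refl = up j refl w , refl

  sequence : Walk {M} zero → TransmissionSequence M
  sequence w = interior w , prepend (interior w) (zero , inj₁ (refl , first-interior w)) (path w)

  sequence-injective : ∀ {w w′} → sequence w ≡ sequence w′ → w ≡ w′
  sequence-injective eq = interior-injective _ _ (≡.cong proj₁ eq)

  sequence-surjective : ∀ s → ∃ λ w → sequence w ≡ s
  sequence-surjective (q , es) with split q es
  ... | (zero , inj₁ (_ , e)) , es′ with walk zero q e es′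
  -- The rebuilt adjacency witnesses agree with the given ones by irrelevance.
  ... | w , refl = w , ≡.cong (interior w ,_) (Linked.irrelevant Adjacent-irrelevant _ es)

  -- The entry j counts the upward crossings of the layer between z_j and z_{j+1},
  -- so that it is k_{j+1}.
  ascents : {p : Fin (2 ℕ.+ M)} → Walk p → Vec ℕ M
  ascents (arrived _)  = replicate M 0
  ascents (up j _ w)   = updateAt (ascents w) j suc
  ascents (down _ _ w) = ascents w

-- Repetition-free enumerations

record Enumeration {A : Set} (P : A → Set) : Set where
  field
    elements : List A
    unique   : Unique elements
    sound    : ∀ {x} → x ∈ elements → P x
    complete : ∀ {x} → P x → x ∈ elements

open Enumeration

module _ {A : Set} where

  none : {P : A → Set} → (∀ x → ¬ P x) → Enumeration P
  none ¬P = record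
    { elements = []
    ; unique   = []
    ; sound    = λ ()
    ; complete = λ {x} Px → contradiction Px (¬P x)
    }

  single : {P : A → Set} (x : A) → P x → (∀ y → P y → y ≡ x) → Enumeration P
  single x Px P⇒≡x = record
    { elements = x ∷ []
    ; unique   = [] ∷ []
    ; sound    = λ { (here refl) → Px }
    ; complete = λ {y} Py → here (P⇒≡x y Py)
    }

  resp : {P Q : A → Set} → (∀ {x} → P x → Q x) → (∀ {x} → Q x → P x) → Enumeration P → Enumeration Q
  resp P⇒Q Q⇒P E = record
    { elements = elements E ; unique = unique E ; sound = P⇒Q ∘ sound E ; complete = complete E ∘ Q⇒P }

  image : ∀ {B} {P : A → Set} (f : A → B) → (∀ {x y} → f x ≡ f y → x ≡ y) →
          Enumeration P → Enumeration (λ y → ∃ λ x → P x × y ≡ f x)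
  image f injective E = record
    { elements = List.map f (elements E)
    ; unique   = Unique.map⁺ injective (unique E)
    ; sound    = λ y∈ → let x , x∈ , y≡fx = ∈-map⁻ f y∈ in x , sound E x∈ , y≡fx
    ; complete = λ { (x , Px , refl) → ∈-map⁺ f (complete E Px) }
    }

  union : {P Q : A → Set} → (∀ {x} → P x → ¬ Q x) → Enumeration P → Enumeration Q → Enumeration (P ∪ Q)
  union disjoint E F = record
    { elements = elements E ++ elements F
    ; unique   = Unique.++⁺ (unique E) (unique F) (λ (x∈E , x∈F) → disjoint (sound E x∈E) (sound F x∈F))
    ; sound    = λ x∈ → [ inj₁ ∘ sound E , inj₂ ∘ sound F ] (∈-++⁻ (elements E) x∈)
    ; complete = [ ∈-++⁺ˡ ∘ complete E , ∈-++⁺ʳ (elements E) ∘ complete F ]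
    }

-- First steps of walks, multi-indices and fibres

module _ {M : ℕ} where

  up-injective : ∀ {p : Fin (2 ℕ.+ M)} {j e w w′} → up {p = p} j e w ≡ up j e w′ → w ≡ w′
  up-injective refl = refl

  down-injective : ∀ {p : Fin (2 ℕ.+ M)} {j e w w′} → down {p = p} j e w ≡ down j e w′ → w ≡ w′
  down-injective refl = refl

  -- Eliminates the equations carried by the constructors of `Walk`. In `ascending` the equation `e`
  -- stays an argument, so that this case can be refuted at z_0.
  data Step (n : Fin (suc M)) : Walk (inject₁ n) → Set where
    ascending  : ∀ j (e : n ≡ suc j) w → Step n (up j (≡.cong inject₁ e) w)
    descending : ∀ w → Step n (down n refl w)

  step : ∀ n (w : Walk (inject₁ n)) → Step n w
  step n (arrived e) = contradiction (≡.sym e) Fin.fromℕ≢inject₁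
  step n (up j e w) with Fin.inject₁-injective e
  ... | refl with uip e refl
  ... | refl = ascending j refl w
  step n (down j e w) with Fin.inject₁-injective e
  ... | refl with uip e refl
  ... | refl = descending w

updateAt-suc-injective : ∀ {n} (j : Fin n) (k k′ : Vec ℕ n) → updateAt k j suc ≡ updateAt k′ j suc → k ≡ k′
updateAt-suc-injective zero    (x ∷ k) (y ∷ k′) eq with Vec.∷-injective eq
... | refl , refl = refl
updateAt-suc-injective (suc j) (x ∷ k) (y ∷ k′) eq with Vec.∷-injective eq
... | refl , eq′ = ≡.cong (x ∷_) (updateAt-suc-injective j k k′ eq′)

sum-updateAt-suc : ∀ {n} (k : Vec ℕ n) j → sum (updateAt k j suc) ≡ suc (sum k)
sum-updateAt-suc (x ∷ k) zero    = refl
sum-updateAt-suc (x ∷ k) (suc j) = ≡.trans (≡.cong (x ℕ.+_) (sum-updateAt-suc k j)) (ℕ.+-suc x (sum k))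

lookup-zero⊎suc : ∀ {n} (k : Vec ℕ n) j → lookup k j ≡ 0 ⊎ ∃ λ k′ → k ≡ updateAt k′ j suc
lookup-zero⊎suc (zero  ∷ k) zero    = inj₁ refl
lookup-zero⊎suc (suc x ∷ k) zero    = inj₂ (x ∷ k , refl)
lookup-zero⊎suc (x     ∷ k) (suc j) with lookup-zero⊎suc k j
... | inj₁ eq          = inj₁ eq
... | inj₂ (k′ , refl) = inj₂ (x ∷ k′ , refl)

-- Fibres over distinct values are disjoint, so their enumerations can be joined.
fibres : ∀ {A K : Set} (h : A → K) → (∀ k → Enumeration (λ x → h x ≡ k)) →
  ∀ {ks} → Unique ks → Enumeration (λ x → h x ∈ ks)
fibres h E []            = none (λ _ ())
fibres h E (k∉ks ∷ ks!) = resp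
  [ here , there ] (λ { (here eq) → inj₁ eq ; (there hx∈) → inj₂ hx∈ })
  (union (λ { refl hx∈ → All.lookup k∉ks hx∈ refl }) (E _) (fibres h E ks!))

box-unique : ∀ {n} (u : Vec ℕ n) → Unique (box u)
box-unique []      = [] ∷ []
box-unique (u ∷ us) = Unique.cartesianProductWith⁺ _∷_ Vec.∷-injective (Unique.upTo⁺ (suc u)) (box-unique us)

-- Failure of membership comes with a coordinate above its bound; that coordinate later forces a
-- late arrival.
∈-box⊎exceeds : ∀ {n} (u k : Vec ℕ n) → k ∈ box u ⊎ ∃ λ i → lookup u i ℕ.< lookup k i
∈-box⊎exceeds []       []       = inj₁ (here refl)
∈-box⊎exceeds (u ∷ us) (k ∷ ks) with ℕ.≤-<-connex k u | ∈-box⊎exceeds us ks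
... | inj₂ u<k | _              = inj₂ (zero , u<k)
... | inj₁ _   | inj₂ (i , u<k) = inj₂ (suc i , u<k)
... | inj₁ k≤u | inj₁ ks∈       = inj₁ (∈-cartesianProductWith⁺ _∷_ (∈-upTo⁺ (s≤s k≤u)) ks∈)

-- ⇑ and ⇓ denote the sides above and below an interface.
data Side : Set where
  ⇑ ⇓ : Side

module _ {c ℓ₁ ℓ₂} (ℝ : RealField c ℓ₁ ℓ₂) where
  open RealField ℝ hiding (zero) renaming (refl to ≈-refl)
  open Scattering ℝ
  open CommutativeRing commutativeRing using (commutativeSemiring; +-monoid)
  open import Algebra.Properties.Monoid.Mult +-monoid using (×-congʳ; ×-homo-+; ×-assocˡ)
  open import Algebra.Properties.Semiring.Mult semiring using (×-comm-*; ×-assoc-*)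
  open import Algebra.Solver.Ring.NaturalCoefficients.Default commutativeSemiring
  open import Relation.Binary.Reasoning.Setoid setoid

  -- Finite sums and Pascal's rule

  ∑< : ℕ → (ℕ → Carrier) → Carrier
  ∑< zero    f = 0#
  ∑< (suc n) f = f 0 + ∑< n (f ∘ suc)

  ∑<-cong : ∀ n {f g} → (∀ m → f m ≈ g m) → ∑< n f ≈ ∑< n g
  ∑<-cong zero    f≈g = ≈-refl
  ∑<-cong (suc n) f≈g = +-cong (f≈g 0) (∑<-cong n (f≈g ∘ suc))

  ∑<-zero : ∀ n {f} → (∀ m → f m ≈ 0#) → ∑< n f ≈ 0#
  ∑<-zero zero    f≈0 = ≈-refl
  ∑<-zero (suc n) f≈0 = trans (+-cong (f≈0 0) (∑<-zero n (f≈0 ∘ suc))) (+-identityˡ 0#)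

  ∑<-+ : ∀ n f g → ∑< n (λ m → f m + g m) ≈ ∑< n f + ∑< n g
  ∑<-+ zero    f g = sym (+-identityˡ 0#)
  ∑<-+ (suc n) f g = begin
    (f 0 + g 0) + ∑< n (λ m → f (suc m) + g (suc m))
      ≈⟨ +-congˡ (∑<-+ n (f ∘ suc) (g ∘ suc)) ⟩
    (f 0 + g 0) + (∑< n (f ∘ suc) + ∑< n (g ∘ suc))
      ≈⟨ solve 4 (λ a b c d → (a :+ b) :+ (c :+ d) := (a :+ c) :+ (b :+ d)) ≈-refl _ _ _ _ ⟩
    (f 0 + ∑< n (f ∘ suc)) + (g 0 + ∑< n (g ∘ suc))   ∎

  *-∑< : ∀ x n f → x * ∑< n f ≈ ∑< n (λ m → x * f m)
  *-∑< x zero    f = zeroʳ x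
  *-∑< x (suc n) f = trans (distribˡ x _ _) (+-congˡ (*-∑< x n (f ∘ suc)))

  ∑<-linear : ∀ x y n f g → x * ∑< n f + y * ∑< n g ≈ ∑< n (λ m → x * f m + y * g m)
  ∑<-linear x y n f g = begin
    x * ∑< n f + y * ∑< n g                    ≈⟨ +-cong (*-∑< x n f) (*-∑< y n g) ⟩
    ∑< n (λ m → x * f m) + ∑< n (λ m → y * g m)  ≈⟨ ∑<-+ n (λ m → x * f m) (λ m → y * g m) ⟨
    ∑< n (λ m → x * f m + y * g m)             ∎

  ∑<-extend : ∀ {n n′} → n ≤ℕ n′ → ∀ {f} → (∀ m → n ≤ℕ m → f m ≈ 0#) → ∑< n f ≈ ∑< n′ f
  ∑<-extend {n′ = n′} z≤n f≈0 = sym (∑<-zero n′ (λ m → f≈0 m z≤n))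
  ∑<-extend (s≤s n≤n′)    f≈0 = +-congˡ (∑<-extend n≤n′ (λ m n≤m → f≈0 (suc m) (s≤s n≤m)))

  ∑ˡ-applyUpTo : ∀ (f : ℕ → Carrier) g n → ∑ˡ (applyUpTo g n) f ≡ ∑< n (f ∘ g)
  ∑ˡ-applyUpTo f g zero    = refl
  ∑ˡ-applyUpTo f g (suc n) = ≡.cong (f (g 0) +_) (∑ˡ-applyUpTo f (g ∘ suc) n)

  -- The coefficient of s^m in (r + s)^x.
  pascal : Carrier → ℕ → ℕ → Carrier
  pascal r x m = (x C m) · r ^ (x ℕ.∸ m)

  pascal-vanishes : ∀ r {x m} → x ℕ.< m → pascal r x m ≈ 0#
  pascal-vanishes r {x} {m} x<m rewrite k>n⇒nCk≡0 x<m = ≈-refl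

  ·-suc-^ : ∀ c r n → c · r ^ suc n ≈ r * (c · r ^ n)
  ·-suc-^ c r n = sym (×-comm-* c r (r ^ n))

  pascal-step-zero : ∀ r x → pascal r (suc x) 0 ≈ r * pascal r x 0
  pascal-step-zero r x = ·-suc-^ (x C 0) r x

  -- Compares coefficients in (r + s)^(x+1) = (r + s) (r + s)^x.
  pascal-step-suc : ∀ r x m → pascal r (suc x) (suc m) ≈ r * pascal r x (suc m) + pascal r x m
  pascal-step-suc r x m = begin
    (suc x C suc m) · r ^ (x ℕ.∸ m)
      ≡⟨ ≡.cong (_· r ^ (x ℕ.∸ m)) (nCk+nC[k+1]≡[n+1]C[k+1] x m) ⟨
    (x C m ℕ.+ x C suc m) · r ^ (x ℕ.∸ m)
      ≡⟨ ≡.cong (_· r ^ (x ℕ.∸ m)) (ℕ.+-comm (x C m) (x C suc m)) ⟩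
    (x C suc m ℕ.+ x C m) · r ^ (x ℕ.∸ m)
      ≈⟨ ×-homo-+ _ (x C suc m) (x C m) ⟩
    (x C suc m) · r ^ (x ℕ.∸ m) + pascal r x m
      ≈⟨ +-congʳ (lower (ℕ.<-≤-connex m x)) ⟩
    r * pascal r x (suc m) + pascal r x m ∎
    where
    -- Truncated subtraction lets a factor `r` be split off only for m < x; otherwise the binomial
    -- coefficient is zero.
    lower : m ℕ.< x ⊎ x ≤ℕ m → (x C suc m) · r ^ (x ℕ.∸ m) ≈ r * pascal r x (suc m)
    lower (inj₁ m<x)
      rewrite ≡.sym (ℕ.suc-pred (x ℕ.∸ m) {{ℕ.>-nonZero (ℕ.m<n⇒0<n∸m m<x)}}) | ℕ.pred[m∸n]≡m∸[1+n] x m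
      = ·-suc-^ (x C suc m) r (x ℕ.∸ suc m)
    lower (inj₂ x≤m)
      rewrite k>n⇒nCk≡0 (s≤s x≤m)
      = sym (zeroʳ r)

  -- Word sums at a single interface

  -- w s s′ is the factor of a visit coming from side s and going to side s′.
  Weights : Set c
  Weights = Side → Side → Carrier

  -- With no exits left, the awaited arrival is from the side of the last exit, which has to be
  -- below.
  final : Side → Carrier
  final ⇑ = 0#
  final ⇓ = 1#

  -- The total weight of the words of u upward and d downward exits from an
  -- interface which arrive first from side s and end with a downward exit;
  -- after an exit to one side, the next arrival is from that side.
  words : Weights → Side → ℕ → ℕ → Carrier
  words w s      zero    zero    = final s
  words w s      (suc u) zero    = w s ⇑ * words w ⇑ u zero
  words w s      zero    (suc d) = w s ⇓ * words w ⇓ zero d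
  words w s      (suc u) (suc d) = w s ⇑ * words w ⇑ u (suc d) + w s ⇓ * words w ⇓ (suc u) d

  -- Without downward exits, every arrival stays from above and the word cannot end downward.
  words-above-zero : ∀ w u → words w ⇑ u 0 ≈ 0#
  words-above-zero w zero    = ≈-refl
  words-above-zero w (suc u) = trans (*-congˡ (words-above-zero w u)) (zeroʳ _)

  words-below-zero : ∀ w u → words w ⇓ (suc u) 0 ≈ 0#
  words-below-zero w u = trans (*-congˡ (words-above-zero w u)) (zeroʳ _)

  weights : Carrier → Carrier → Weights
  weights r t ⇑ ⇑ = r
  weights r t ⇑ ⇓ = t
  weights r t ⇓ ⇑ = t
  weights r t ⇓ ⇓ = - r

  module _ (r t : Carrier) where
    private
      w = weights r t
      q = - r

    -- Words grouped by transmissions: `suc m` downward in both, and upward `m` in `fromAbove`,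
    -- `suc m` in `fromBelow`. The binomials count the ways to cut the upward and the downward exits
    -- into runs. There are `x` upward and `suc y` downward exits in `fromAbove`, `suc x` and `y` in
    -- `fromBelow`.
    fromAbove fromBelow : ℕ → ℕ → ℕ → Carrier
    fromAbove x y m = pascal r x m * pascal q y m * t ^ suc (m ℕ.+ m)
    fromBelow x y m = pascal r x m * pascal q y (suc m) * t ^ suc (suc (m ℕ.+ m))

    -- Mutual induction on the first exit. From above, the recursion is Pascal's rule in the upward
    -- exits; from below, in the downward ones. Without upward exits only reflections from below
    -- occur.
    words-above : ∀ x y → words w ⇑ x (suc y) ≈ ∑< (suc x) (fromAbove x y)
    words-below : ∀ x y → words w ⇓ (suc x) y ≈ ∑< (suc x) (fromBelow x y)
    words-below-no-up : ∀ y → words w ⇓ 0 y ≈ pascal q y 0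

    words-below-no-up zero    = sym (+-identityʳ _)
    words-below-no-up (suc y) = trans (*-congˡ (words-below-no-up y)) (sym (pascal-step-zero q y))

    words-above zero y = begin
      t * words w ⇓ 0 y
        ≈⟨ *-congˡ (words-below-no-up y) ⟩
      t * p
        ≈⟨ solve 2 (λ t p → t :* p := (con 1 :+ con 0) :* p :* (t :* con 1) :+ con 0) ≈-refl t p ⟩
      ∑< 1 (fromAbove 0 y) ∎
      where p = pascal q y 0
    words-above (suc x) y = begin
      r * words w ⇑ x (suc y) + t * words w ⇓ (suc x) y
        -- A vanishing last term is appended so that, once the term at 0 is split off, both sums
        -- have `suc x` terms with equal numbers of upward transmissions.
        ≈⟨ +-cong (*-congˡ (trans (words-above x y) (∑<-extend (ℕ.n≤1+n (suc x)) vanish)))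
                  (*-congˡ (words-below x y)) ⟩
      r * ∑< (suc (suc x)) (fromAbove x y) + t * ∑< (suc x) (fromBelow x y)
        ≈⟨ trans (+-congʳ (distribˡ r _ _)) (+-assoc _ _ _) ⟩
      r * fromAbove x y 0 + (r * ∑< (suc x) (fromAbove x y ∘ suc) + t * ∑< (suc x) (fromBelow x y))
        ≈⟨ +-congˡ (∑<-linear r t (suc x) (fromAbove x y ∘ suc) (fromBelow x y)) ⟩
      r * fromAbove x y 0 + ∑< (suc x) (λ m → r * fromAbove x y (suc m) + t * fromBelow x y m)
        ≈⟨ +-cong term-zero (∑<-cong (suc x) term-suc) ⟩
      ∑< (suc (suc x)) (fromAbove (suc x) y) ∎
      where
      vanish : ∀ m → suc x ≤ℕ m → fromAbove x y m ≈ 0#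
      vanish m x<m = trans (*-congʳ (trans (*-congʳ (pascal-vanishes r x<m)) (zeroˡ _))) (zeroˡ _)

      term-zero : r * fromAbove x y 0 ≈ fromAbove (suc x) y 0
      term-zero = begin
        r * (pascal r x 0 * pascal q y 0 * t ^ 1)
          ≈⟨ solve 4 (λ r a b t → r :* (a :* b :* t) := (r :* a) :* b :* t) ≈-refl r _ _ _ ⟩
        (r * pascal r x 0) * pascal q y 0 * t ^ 1
          ≈⟨ *-congʳ (*-congʳ (sym (pascal-step-zero r x))) ⟩
        fromAbove (suc x) y 0 ∎

      term-suc : ∀ m → r * fromAbove x y (suc m) + t * fromBelow x y m ≈ fromAbove (suc x) y (suc m)
      term-suc m rewrite ℕ.+-suc m m = begin
        r * (pascal r x (suc m) * pascal q y (suc m) * t³) + t * (pascal r x m * pascal q y (suc m) * t²)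
          ≈⟨ solve 6 (λ r a b t c t² → r :* (a :* b :* (t :* t²)) :+ t :* (c :* b :* t²)
                                     := (r :* a :+ c) :* b :* (t :* t²)) ≈-refl r _ _ t _ _ ⟩
        (r * pascal r x (suc m) + pascal r x m) * pascal q y (suc m) * t³
          ≈⟨ *-congʳ {x = t³} (*-congʳ {x = pascal q y (suc m)} (sym (pascal-step-suc r x m))) ⟩
        pascal r (suc x) (suc m) * pascal q y (suc m) * t³ ∎
        where
        t² = t ^ suc (suc (m ℕ.+ m))
        t³ = t * t²

    words-below x zero = begin
      words w ⇓ (suc x) 0              ≈⟨ words-below-zero w x ⟩
      0#                               ≈⟨ ∑<-zero (suc x) vanish ⟨
      ∑< (suc x) (fromBelow x 0)       ∎
      where
      vanish : ∀ m → fromBelow x 0 m ≈ 0#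
      vanish m = begin
        pascal r x m * pascal q 0 (suc m) * t ^ suc (suc (m ℕ.+ m))
          ≈⟨ *-congʳ {x = t ^ suc (suc (m ℕ.+ m))}
               (*-congˡ {x = pascal r x m} (pascal-vanishes q {0} {suc m} (s≤s z≤n))) ⟩
        pascal r x m * 0# * t ^ suc (suc (m ℕ.+ m))
          ≈⟨ trans (*-congʳ (zeroʳ _)) (zeroˡ _) ⟩
        0# ∎
    words-below x (suc y) = begin
      t * words w ⇑ x (suc y) + q * words w ⇓ (suc x) y
        ≈⟨ +-cong (*-congˡ (words-above x y)) (*-congˡ (words-below x y)) ⟩
      t * ∑< (suc x) (fromAbove x y) + q * ∑< (suc x) (fromBelow x y)
        ≈⟨ ∑<-linear t q (suc x) (fromAbove x y) (fromBelow x y) ⟩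
      ∑< (suc x) (λ m → t * fromAbove x y m + q * fromBelow x y m)
        ≈⟨ ∑<-cong (suc x) term ⟩
      ∑< (suc x) (fromBelow x (suc y)) ∎
      where
      term : ∀ m → t * fromAbove x y m + q * fromBelow x y m ≈ fromBelow x (suc y) m
      term m = begin
        t * (pascal r x m * pascal q y m * t¹) + q * (pascal r x m * pascal q y (suc m) * (t * t¹))
          ≈⟨ solve 6 (λ t a b t¹ q b′ → t :* (a :* b :* t¹) :+ q :* (a :* b′ :* (t :* t¹))
                                     := a :* (q :* b′ :+ b) :* (t :* t¹)) ≈-refl t _ _ _ q _ ⟩
        pascal r x m * (q * pascal q y (suc m) + pascal q y m) * (t * t¹)
          ≈⟨ *-congʳ {x = t * t¹} (*-congˡ {x = pascal r x m} (sym (pascal-step-suc q y m))) ⟩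
        fromBelow x (suc y) m ∎
        where t¹ = t ^ suc (m ℕ.+ m)

    -- The share of one interface in a summand of `b`.
    wordTerm : ℕ → ℕ → ℕ → Carrier
    wordTerm x y m = ((x C m) ℕ.* (y C m)) · (q ^ (y ℕ.∸ m) * r ^ (x ℕ.∸ m) * t ^ (2 ℕ.* m ℕ.+ 1))

    wordTerm≈fromAbove : ∀ x y m → wordTerm x y m ≈ fromAbove x y m
    wordTerm≈fromAbove x y m
      rewrite ℕ.+-comm (2 ℕ.* m) 1 | ℕ.+-identityʳ m = begin
      ((x C m) ℕ.* (y C m)) · (Q * P * T)
        ≈⟨ ×-assocˡ (Q * P * T) (x C m) (y C m) ⟨
      (x C m) · ((y C m) · (Q * P * T)) ≈⟨ ×-congʳ (x C m) (×-assoc-* (y C m) (Q * P) T) ⟨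
      (x C m) · ((y C m) · (Q * P) * T) ≈⟨ ×-congʳ (x C m) (*-congʳ (×-assoc-* (y C m) Q P)) ⟨
      (x C m) · ((y C m) · Q * P * T)   ≈⟨ ×-assoc-* (x C m) ((y C m) · Q * P) T ⟨
      (x C m) · ((y C m) · Q * P) * T   ≈⟨ *-congʳ (×-comm-* (x C m) ((y C m) · Q) P) ⟨
      (y C m) · Q * ((x C m) · P) * T   ≈⟨ *-congʳ (*-comm ((y C m) · Q) ((x C m) · P)) ⟩
      fromAbove x y m                   ∎
      where
      P = r ^ (x ℕ.∸ m)
      Q = q ^ (y ℕ.∸ m)
      T = t ^ suc (m ℕ.+ m)

    -- Beyond `x ⊓ y` one of the two binomials vanishes, so the range may be extended up to `x`.
    words-formula : ∀ x y → ∑< (suc (x ℕ.⊓ y)) (wordTerm x y) ≈ words w ⇑ x (suc y)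
    words-formula x y = begin
      ∑< (suc (x ℕ.⊓ y)) (wordTerm x y)   ≈⟨ ∑<-cong (suc (x ℕ.⊓ y)) (wordTerm≈fromAbove x y) ⟩
      ∑< (suc (x ℕ.⊓ y)) (fromAbove x y)  ≈⟨ ∑<-extend (s≤s (ℕ.m⊓n≤m x y)) vanish ⟩
      ∑< (suc x) (fromAbove x y)          ≈⟨ words-above x y ⟨
      words w ⇑ x (suc y)                 ∎
      where
      vanish : ∀ m → x ℕ.⊓ y ℕ.< m → fromAbove x y m ≈ 0#
      vanish m x⊓y<m with ℕ.≤-total x y
      ... | inj₁ x≤y = trans (*-congʳ (trans (*-congʳ (pascal-vanishes r x<m)) (zeroˡ (pascal q y m)))) (zeroˡ _)
        where x<m = ≡.subst (ℕ._< m) (ℕ.m≤n⇒m⊓n≡m x≤y) x⊓y<m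
      ... | inj₂ y≤x = trans (*-congʳ (trans (*-congˡ (pascal-vanishes q y<m)) (zeroʳ (pascal r x m)))) (zeroˡ _)
        where y<m = ≡.subst (ℕ._< m) (ℕ.m≥n⇒m⊓n≡n y≤x) x⊓y<m

  -- Sums over lists

  module _ {a} {A : Set a} where
    ∑ˡ-cong : ∀ (xs : List A) {f g} → (∀ x → f x ≈ g x) → ∑ˡ xs f ≈ ∑ˡ xs g
    ∑ˡ-cong []       f≈g = ≈-refl
    ∑ˡ-cong (x ∷ xs) f≈g = +-cong (f≈g x) (∑ˡ-cong xs f≈g)

    ∑ˡ-++ : ∀ (xs ys : List A) f → ∑ˡ (xs ++ ys) f ≈ ∑ˡ xs f + ∑ˡ ys f
    ∑ˡ-++ []       ys f = sym (+-identityˡ _)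
    ∑ˡ-++ (x ∷ xs) ys f = trans (+-congˡ (∑ˡ-++ xs ys f)) (sym (+-assoc _ _ _))

    *-∑ˡ : ∀ c (xs : List A) f → c * ∑ˡ xs f ≈ ∑ˡ xs (λ x → c * f x)
    *-∑ˡ c []       f = zeroʳ c
    *-∑ˡ c (x ∷ xs) f = trans (distribˡ c _ _) (+-congˡ (*-∑ˡ c xs f))

    ∑ˡ-map : ∀ {b} {B : Set b} (g : B → A) xs f → ∑ˡ (List.map g xs) f ≡ ∑ˡ xs (f ∘ g)
    ∑ˡ-map g []       f = refl
    ∑ˡ-map g (x ∷ xs) f = ≡.cong (f (g x) +_) (∑ˡ-map g xs f)

  ∑ˡ-map-* : ∀ {a b} {A : Set a} {B : Set b} (g : B → A) xs {f} x {h} → (∀ y → f (g y) ≈ x * h y) →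
    ∑ˡ (List.map g xs) f ≈ x * ∑ˡ xs h
  ∑ˡ-map-* g xs {f} x {h} f∘g≈xh = begin
    ∑ˡ (List.map g xs) f         ≡⟨ ∑ˡ-map g xs f ⟩
    ∑ˡ xs (f ∘ g)                ≈⟨ ∑ˡ-cong xs f∘g≈xh ⟩
    ∑ˡ xs (λ y → x * h y)        ≈⟨ *-∑ˡ x xs h ⟨
    x * ∑ˡ xs h                  ∎

  ∑ˡ-cong-∈ : ∀ {a} {A : Set a} (xs : List A) {f g} → (∀ {x} → x ∈ xs → f x ≈ g x) → ∑ˡ xs f ≈ ∑ˡ xs g
  ∑ˡ-cong-∈ []       f≈g = ≈-refl
  ∑ˡ-cong-∈ (x ∷ xs) f≈g = +-cong (f≈g (here refl)) (∑ˡ-cong-∈ xs (f≈g ∘ there))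

  ∑ˡ-fibres : ∀ {A K : Set} (h : A → K) (E : ∀ k → Enumeration (λ x → h x ≡ k)) {ks} (ks! : Unique ks) f →
    ∑ˡ (elements (fibres h E ks!)) f ≈ ∑ˡ ks (λ k → ∑ˡ (elements (E k)) f)
  ∑ˡ-fibres h E []         f = ≈-refl
  ∑ˡ-fibres h E (_ ∷ ks!) f = trans (∑ˡ-++ (elements (E _)) _ f) (+-congˡ (∑ˡ-fibres h E ks! f))

  ∑ˡ-cartesianProductWith : ∀ {a b d} {A : Set a} {B : Set b} {D : Set d} (p : A → B → D) xs ys {f g h} →
    (∀ x y → f (p x y) ≈ g x * h y) →
    ∑ˡ (cartesianProductWith p xs ys) f ≈ ∑ˡ xs g * ∑ˡ ys h
  ∑ˡ-cartesianProductWith p []       ys f≈gh = sym (zeroˡ _)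
  ∑ˡ-cartesianProductWith p (x ∷ xs) ys {f} {g} {h} f≈gh = begin
    ∑ˡ (List.map (p x) ys ++ cartesianProductWith p xs ys) f
      ≈⟨ ∑ˡ-++ (List.map (p x) ys) _ f ⟩
    ∑ˡ (List.map (p x) ys) f + ∑ˡ (cartesianProductWith p xs ys) f
      ≈⟨ +-cong (reflexive (∑ˡ-map (p x) ys f)) (∑ˡ-cartesianProductWith p xs ys f≈gh) ⟩
    ∑ˡ ys (f ∘ p x) + ∑ˡ xs g * ∑ˡ ys h
      ≈⟨ +-congʳ (trans (∑ˡ-cong ys (f≈gh x)) (sym (*-∑ˡ (g x) ys h))) ⟩
    g x * ∑ˡ ys h + ∑ˡ xs g * ∑ˡ ys h
      ≈⟨ distribʳ (∑ˡ ys h) (g x) (∑ˡ xs g) ⟨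
    (g x + ∑ˡ xs g) * ∑ˡ ys h ∎

  -- Factorization of the coefficients over the interfaces

  coefficientTerm : ∀ {n} (R : Vector Carrier n) (x y m : Vec ℕ n) → Carrier
  coefficientTerm R x y m =
    (binom x m ℕ.* binom y m) ·
      (((λ n → - R n) ^ᵛ (y ∸ᵛ m)) * (R ^ᵛ (x ∸ᵛ m)) * (transmission R ^ᵛ (2* m +𝟙)))

  -- Equals `b R x` when `y` is `shift x`; independent and possibly empty multi-indices permit
  -- induction on the length.
  coefficient : ∀ {n} (R : Vector Carrier n) (x y : Vec ℕ n) → Carrier
  coefficient R x y = ∑ˡ (box (minᵛ x y)) (coefficientTerm R x y)

  coefficient-[] : ∀ R → coefficient R [] [] ≈ 1#
  coefficient-[] R = solve 0 ((con 1 :* con 1 :* con 1 :+ con 0) :+ con 0 := con 1) ≈-refl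

  ·-* : ∀ m n x y → (m ℕ.* n) · (x * y) ≈ m · x * (n · y)
  ·-* m n x y = begin
    (m ℕ.* n) · (x * y)   ≈⟨ ×-assocˡ (x * y) m n ⟨
    m · (n · (x * y))     ≈⟨ ×-congʳ m (×-comm-* n x y) ⟨
    m · (x * (n · y))     ≈⟨ ×-assoc-* m x (n · y) ⟨
    m · x * (n · y)       ∎

  -- Each summand is a product over entries, so the sum over the box is a product of sums, the first
  -- of which is a word sum.
  coefficient-∷ : ∀ {n} R u (x : Vec ℕ n) v y →
    coefficient R (u ∷ x) (v ∷ y) ≈
      words (weights (R zero) (transmission R zero)) ⇑ u (suc v) * coefficient (R ∘ suc) x y
  coefficient-∷ R u x v y = begin
    coefficient R (u ∷ x) (v ∷ y)
      ≈⟨ ∑ˡ-cartesianProductWith _∷_ (upTo (suc (u ℕ.⊓ v))) (box (minᵛ x y)) term ⟩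
    ∑ˡ (upTo (suc (u ℕ.⊓ v))) (wordTerm r t u v) * coefficient (R ∘ suc) x y
      ≡⟨ ≡.cong (_* coefficient (R ∘ suc) x y) (∑ˡ-applyUpTo (wordTerm r t u v) id (suc (u ℕ.⊓ v))) ⟩
    ∑< (suc (u ℕ.⊓ v)) (wordTerm r t u v) * coefficient (R ∘ suc) x y
      ≈⟨ *-congʳ (words-formula r t u v) ⟩
    words (weights r t) ⇑ u (suc v) * coefficient (R ∘ suc) x y ∎
    where
    r = R zero
    t = transmission R zero

    term : ∀ m ms → coefficientTerm R (u ∷ x) (v ∷ y) (m ∷ ms) ≈
                    wordTerm r t u v m * coefficientTerm (R ∘ suc) x y ms
    term m ms = begin
      (((u C m) ℕ.* bx) ℕ.* ((v C m) ℕ.* by)) · (q * Q * (p * P) * (s * S))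
        ≡⟨ ≡.cong (_· (q * Q * (p * P) * (s * S))) (ℕ.[m*n]*[o*p]≡[m*o]*[n*p] (u C m) bx (v C m) by) ⟩
      (((u C m) ℕ.* (v C m)) ℕ.* (bx ℕ.* by)) · (q * Q * (p * P) * (s * S))
        ≈⟨ ×-congʳ (((u C m) ℕ.* (v C m)) ℕ.* (bx ℕ.* by))
             (solve 6 (λ q Q p P s S → q :* Q :* (p :* P) :* (s :* S)
                                     := (q :* p :* s) :* (Q :* P :* S)) ≈-refl q Q p P s S) ⟩
      (((u C m) ℕ.* (v C m)) ℕ.* (bx ℕ.* by)) · ((q * p * s) * (Q * P * S))
        ≈⟨ ·-* ((u C m) ℕ.* (v C m)) (bx ℕ.* by) _ _ ⟩
      wordTerm r t u v m * coefficientTerm (R ∘ suc) x y ms ∎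
      where
      bx = binom x ms
      by = binom y ms
      q = (- r) ^ (v ℕ.∸ m)
      Q = (λ n → - R (suc n)) ^ᵛ (y ∸ᵛ ms)
      p = r ^ (u ℕ.∸ m)
      P = (R ∘ suc) ^ᵛ (x ∸ᵛ ms)
      s = t ^ (2 ℕ.* m ℕ.+ 1)
      S = transmission (R ∘ suc) ^ᵛ (2* ms +𝟙)

  -- Single-step recursion for the product of word sums

  *-swap : ∀ x y z → x * (y * z) ≈ y * (x * z)
  *-swap = solve 3 (λ x y z → x :* (y :* z) := y :* (x :* z)) ≈-refl

  *-swap-+ : ∀ x y z y′ z′ → x * (y * z + y′ * z′) ≈ y * (x * z) + y′ * (x * z′)
  *-swap-+ = solve 5 (λ x y z y′ z′ → x :* (y :* z :+ y′ :* z′) := y :* (x :* z) :+ y′ :* (x :* z′)) ≈-refl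

  -- The product of the word sums of the interfaces, for a walk that arrives at z_p
  -- from side s and has u ascents left through the layer above z_0 and k through the
  -- others.  The next arrival is from below at the interfaces above z_p, and from
  -- above at those below z_p, which still owe one more descent than ascents.
  layered : ∀ {m} (W : Fin (suc m) → Weights) → Fin (2 ℕ.+ m) → Side → ℕ → Vec ℕ m → Carrier
  layered W zero       s u []      = words (W zero) s u 1
  layered W (suc _)    s u []      = words (W zero) ⇓ u 0
  layered W zero       s u (d ∷ k) = words (W zero) s u (suc d) * layered (W ∘ suc) zero ⇑ d k
  layered W (suc p)    s u (d ∷ k) = words (W zero) ⇓ u d * layered (W ∘ suc) p s d k

  -- Apart from the one extra descent, the downward exits of an interface number as many as the
  -- upward exits of the next. The last interface has only the extra descent, hence the final 0.
  layered-start : ∀ {m} (R : Vector Carrier (suc m)) u k →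
    layered (λ n → weights (R n) (transmission R n)) zero ⇑ u k ≈ coefficient R (u ∷ k) (k Vec.∷ʳ 0)
  layered-start R u []      = begin
    words w ⇑ u 1                                  ≈⟨ *-identityʳ _ ⟨
    words w ⇑ u 1 * 1#                             ≈⟨ *-congˡ (coefficient-[] (R ∘ suc)) ⟨
    words w ⇑ u 1 * coefficient (R ∘ suc) [] []    ≈⟨ coefficient-∷ R u [] 0 [] ⟨
    coefficient R (u ∷ []) (0 ∷ [])                ∎
    where w = weights (R zero) (transmission R zero)
  layered-start R u (d ∷ k) =
    trans (*-congˡ (layered-start (R ∘ suc) d k)) (sym (coefficient-∷ R u (d ∷ k) d (k Vec.∷ʳ 0)))

  -- All interfaces await an arrival from below and all words are empty, so each factor is
  -- `final ⇓`.
  layered-receiver-zero : ∀ {m} (W : Fin (suc m) → Weights) s →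
    layered W (fromℕ (suc m)) s 0 (replicate m 0) ≈ 1#
  layered-receiver-zero {zero}  W s = ≈-refl
  layered-receiver-zero {suc m} W s = trans (*-identityˡ _) (layered-receiver-zero (W ∘ suc) s)

  -- The last nonzero entry belongs to an interface with upward but no downward exits left, whose
  -- word sum vanishes.
  layered-receiver-nonzero : ∀ {m} (W : Fin (suc m) → Weights) s u k →
    u ∷ k ≢ replicate (suc m) 0 → layered W (fromℕ (suc m)) s u k ≈ 0#
  layered-receiver-nonzero W s zero    []      ≢0 = contradiction refl ≢0
  layered-receiver-nonzero W s (suc u) []      ≢0 = words-below-zero (W zero) u
  layered-receiver-nonzero W s u       (d ∷ k) ≢0 with Vec.≡-dec ℕ._≟_ (d ∷ k) (replicate _ 0)
  ... | no  dk≢0 = trans (*-congˡ (layered-receiver-nonzero (W ∘ suc) s d k dk≢0)) (zeroʳ _)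
  layered-receiver-nonzero W s zero    (d ∷ k) ≢0 | yes dk≡0 = contradiction (≡.cong (0 ∷_) dk≡0) ≢0
  layered-receiver-nonzero W s (suc u) (d ∷ k) ≢0 | yes refl =
    trans (*-congʳ (words-below-zero (W zero) u)) (zeroˡ _)

  layered-first-0 : ∀ {m} (W : Fin (suc m) → Weights) s k →
    layered W zero s 0 k ≈ W zero s ⇓ * layered W (suc zero) ⇑ 0 k
  layered-first-0 W s []      = ≈-refl
  layered-first-0 W s (d ∷ k) = *-assoc _ _ _

  layered-first-suc : ∀ {m} (W : Fin (suc m) → Weights) s u k →
    layered W zero s (suc u) k ≈
      W zero s ⇑ * layered W zero ⇑ u k + W zero s ⇓ * layered W (suc zero) ⇑ (suc u) k
  layered-first-suc W s u []      = ≈-refl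
  layered-first-suc W s u (d ∷ k) =
    solve 5 (λ x a y b l → (x :* a :+ y :* b) :* l := x :* (a :* l) :+ y :* (b :* l)) ≈-refl
      (W zero s ⇑) (words (W zero) ⇑ u (suc d)) (W zero s ⇓) (words (W zero) ⇓ (suc u) d)
      (layered (W ∘ suc) zero ⇑ d k)

  layered-next-0 : ∀ {m} (W : Fin (suc m) → Weights) s u k (j : Fin m) → lookup k j ≡ 0 →
    layered W (inject₁ (suc j)) s u k ≈ W (suc j) s ⇓ * layered W (suc (suc j)) ⇑ u k
  layered-next-0 W s u (d ∷ k) zero    refl =
    trans (*-congˡ (layered-first-0 (W ∘ suc) s k)) (*-swap _ _ _)
  layered-next-0 W s u (d ∷ k) (suc j) kⱼ≡0 =
    trans (*-congˡ (layered-next-0 (W ∘ suc) s d k j kⱼ≡0)) (*-swap _ _ _)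

  -- Only the word sum of the current interface unfolds. After an ascent the interface above becomes
  -- current and owes an extra descent, so its number of downward exits is unchanged although the
  -- entry `j` has dropped by one.
  layered-next-suc : ∀ {m} (W : Fin (suc m) → Weights) s u k (j : Fin m) →
    layered W (inject₁ (suc j)) s u (Vec.updateAt k j suc) ≈
      W (suc j) s ⇑ * layered W (inject₁ (inject₁ j)) ⇓ u k +
      W (suc j) s ⇓ * layered W (suc (suc j)) ⇑ u (Vec.updateAt k j suc)
  layered-next-suc W s u (d ∷ k) zero =
    trans (*-congˡ (layered-first-suc (W ∘ suc) s d k)) (*-swap-+ _ _ _ _ _)
  layered-next-suc W s u (d ∷ k) (suc j) =
    trans (*-congˡ (layered-next-suc (W ∘ suc) s d k j)) (*-swap-+ _ _ _ _ _)

  -- Enumeration of the walks with given ascents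

  walkWeight : ∀ {M} {p : Fin (2 ℕ.+ M)} → (Fin (suc M) → Weights) → Side → Walk p → Carrier
  walkWeight W s (arrived _)  = 1#
  walkWeight W s (up j _ w)   = W (suc j) s ⇑ * walkWeight W ⇓ w
  walkWeight W s (down j _ w) = W j s ⇓ * walkWeight W ⇑ w

  -- One enumeration serves all weights and both arrival sides, since the side changes along the
  -- induction. The argument 0 of `layered` records that no walk returns to the source.
  record Walks {M} (p : Fin (2 ℕ.+ M)) (k : Vec ℕ M) : Set (c ⊔ ℓ₁) where
    field
      enumeration : Enumeration {Walk p} (λ w → ascents w ≡ k)
      total       : ∀ W s → ∑ˡ (elements enumeration) (walkWeight W s) ≈ layered W p s 0 k

  open Walks

  module _ {M : ℕ} where

    receiverWalks : ∀ k → Walks (fromℕ (suc M)) k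
    receiverWalks k with Vec.≡-dec ℕ._≟_ k (replicate M 0)
    ... | yes refl = record
      { enumeration = single (arrived refl) refl only
      ; total       = λ W s → trans (+-identityʳ 1#) (sym (layered-receiver-zero W s))
      }
      where
      only : ∀ (w : Walk (fromℕ (suc M))) → ascents w ≡ replicate M 0 → w ≡ arrived refl
      only (arrived e)  _ = ≡.cong arrived (uip e refl)
      only (up j e w)   _ = contradiction e Fin.fromℕ≢inject₁
      only (down j e w) _ = contradiction e Fin.fromℕ≢inject₁
    ... | no k≢0 = record
      { enumeration = none λ
        { (arrived _)  eq → k≢0 (≡.sym eq)
        ; (up _ e _)   _  → Fin.fromℕ≢inject₁ e
        ; (down _ e _) _  → Fin.fromℕ≢inject₁ e
        }
      ; total       = λ W s → sym (layered-receiver-nonzero W s 0 k (λ eq → k≢0 (Vec.∷-injectiveʳ eq)))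
      }

    Descends : ∀ n → Vec ℕ M → Walk (inject₁ n) → Set
    Descends n k w = ∃ λ w′ → ascents w′ ≡ k × w ≡ down n refl w′

    Ascends : ∀ j → Vec ℕ M → Walk (inject₁ (suc j)) → Set
    Ascends j k w = ∃ λ w′ → ascents w′ ≡ k × w ≡ up j refl w′

    descents : ∀ {n k} → Walks (suc n) k → Enumeration (Descends n k)
    descents Ws = image (down _ refl) down-injective (enumeration Ws)

    total-descents : ∀ {n k} (Ws : Walks (suc n) k) W s →
      ∑ˡ (elements (descents Ws)) (walkWeight W s) ≈ W n s ⇓ * layered W (suc n) ⇑ 0 k
    total-descents {n} Ws W s = trans
      (∑ˡ-map-* (down n refl) (elements (enumeration Ws)) (W n s ⇓) (λ _ → ≈-refl))
      (*-congˡ (total Ws W ⇑))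

    walksFromTop : ∀ k → Walks (suc zero) k → Walks zero k
    walksFromTop k Ws = record
      { enumeration = resp (λ { (w , eq , refl) → eq }) (λ {w} → descends w) (descents Ws)
      ; total       = λ W s → trans (total-descents Ws W s) (sym (layered-first-0 W s k))
      }
      where
      descends : ∀ w → ascents w ≡ k → Descends zero k w
      descends w eq with step zero w
      ... | descending w′ = w′ , eq , refl

    walksNoAscent : ∀ j k → lookup k j ≡ 0 → Walks (suc (suc j)) k → Walks (inject₁ (suc j)) k
    walksNoAscent j k kⱼ≡0 Ws = record
      { enumeration = resp (λ { (w , eq , refl) → eq }) (λ {w} → descends w) (descents Ws)
      ; total       = λ W s → trans (total-descents Ws W s) (sym (layered-next-0 W s 0 k j kⱼ≡0))
      }
      where
      descends : ∀ w → ascents w ≡ k → Descends (suc j) k w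
      descends w eq with step (suc j) w
      ... | descending w′       = w′ , eq , refl
      ... | ascending j refl w′ = contradiction
        (≡.trans (≡.sym (Vec.lookup∘updateAt j (ascents w′))) (≡.trans (≡.cong (λ k → lookup k j) eq) kⱼ≡0))
        λ ()

    walksWithAscent : ∀ j k → Walks (inject₁ (inject₁ j)) k → Walks (suc (suc j)) (updateAt k j suc) →
      Walks (inject₁ (suc j)) (updateAt k j suc)
    walksWithAscent j k Us Ds = record
      { enumeration = resp
          (λ { (inj₁ (w , refl , refl)) → refl ; (inj₂ (w , eq , refl)) → eq })
          (λ {w} → moves w)
          (union (λ { (_ , _ , refl) (_ , _ , ()) }) ascending-walks (descents Ds))
      ; total       = λ W s → begin
          ∑ˡ (elements ascending-walks ++ elements (descents Ds)) (walkWeight W s)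
            ≈⟨ ∑ˡ-++ (elements ascending-walks) _ (walkWeight W s) ⟩
          ∑ˡ (elements ascending-walks) (walkWeight W s) + ∑ˡ (elements (descents Ds)) (walkWeight W s)
            ≈⟨ +-cong (trans (∑ˡ-map-* (up j refl) (elements (enumeration Us)) (W (suc j) s ⇑) (λ _ → ≈-refl))
                             (*-congˡ (total Us W ⇓)))
                      (total-descents Ds W s) ⟩
          W (suc j) s ⇑ * layered W (inject₁ (inject₁ j)) ⇓ 0 k +
          W (suc j) s ⇓ * layered W (suc (suc j)) ⇑ 0 (updateAt k j suc)
            ≈⟨ layered-next-suc W s 0 k j ⟨
          layered W (inject₁ (suc j)) s 0 (updateAt k j suc) ∎
      }
      where
      ascending-walks : Enumeration (Ascends j k)
      ascending-walks = image (up j refl) up-injective (enumeration Us)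

      moves : ∀ w → ascents w ≡ updateAt k j suc → (Ascends j k ∪ Descends (suc j) (updateAt k j suc)) w
      moves w eq with step (suc j) w
      ... | descending w′       = inj₂ (w′ , eq , refl)
      ... | ascending j refl w′ = inj₁ (w′ , updateAt-suc-injective j (ascents w′) k eq , refl)

    -- A walk from z_p with ascents k has 2 ∑ k + (M + 1) - p steps.
    walks : ∀ fuel (p : Fin (2 ℕ.+ M)) k → 2 ℕ.* sum k ℕ.+ suc M ℕ.< fuel ℕ.+ toℕ p → Walks p k
    -- Without fuel the bound would place `p` beyond the receiver.
    walks zero       p k bound = contradiction
      (ℕ.≤-trans bound (Fin.toℕ≤pred[n] p)) (ℕ.<⇒≱ (s≤s (ℕ.m≤n+m (suc M) (2 ℕ.* sum k))))
    walks (suc fuel) p k bound with view p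
    ... | ‵fromℕ         = receiverWalks k
    ... | ‵inject₁ zero  = walksFromTop k
      (walks fuel (suc zero) k (ℕ.≤-trans bound (ℕ.≤-reflexive (≡.sym (ℕ.+-suc fuel 0)))))
    ... | ‵inject₁ (suc j) = case lookup-zero⊎suc k j of λ
      { (inj₁ kⱼ≡0)        → walksNoAscent j k kⱼ≡0 Ds
      ; (inj₂ (k′ , refl)) → walksWithAscent j k′
          (walks fuel (inject₁ (inject₁ j)) k′ (bound-ascending k′ bound)) Ds
      }
      where
      Ds : Walks (suc (suc j)) k
      -- A descent spends one unit of fuel and raises `p` by one, so the bound persists.
      Ds = walks fuel (suc (suc j)) k (ℕ.≤-trans bound (ℕ.≤-reflexive
        (≡.trans (≡.cong (λ i → suc fuel ℕ.+ suc i) (Fin.toℕ-inject₁ j)) (≡.sym (ℕ.+-suc fuel (suc (toℕ j)))))))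

      -- An ascent lowers twice the sum by two, and the fuel and `p` by one each.
      bound-ascending : ∀ k′ →
        2 ℕ.* sum (updateAt k′ j suc) ℕ.+ suc M ℕ.< suc fuel ℕ.+ suc (toℕ (inject₁ j)) →
        2 ℕ.* sum k′ ℕ.+ suc M ℕ.< fuel ℕ.+ toℕ (inject₁ (inject₁ j))
      bound-ascending k′ bound
        rewrite sum-updateAt-suc k′ j | ℕ.+-suc (sum k′) (sum k′ ℕ.+ 0)
              | ℕ.+-suc fuel (toℕ (inject₁ j)) | Fin.toℕ-inject₁ (inject₁ j)
        = s≤s⁻¹ (s≤s⁻¹ bound)

  -- Order and the Archimedean property

  +-monoˡ-< : ∀ z {x y} → x < y → x + z < y + z
  +-monoˡ-< z x<y = <-respʳ-≈ (+-comm z _) (<-respˡ-≈ (+-comm z _) (+-monoʳ-< z x<y))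

  *-monoˡ-< : ∀ {x y z} → 0# < z → x < y → x * z < y * z
  *-monoˡ-< {x} {y} {z} 0<z x<y =
    <-respʳ-≈ rhs (<-respˡ-≈ (+-identityʳ _) (+-monoʳ-< (x * z) (*-pos 0<y-x 0<z)))
    where
    0<y-x : 0# < y + - x
    0<y-x = <-respˡ-≈ (-‿inverseʳ x) (+-monoˡ-< (- x) x<y)

    rhs : x * z + (y + - x) * z ≈ y * z
    rhs = begin
      x * z + (y + - x) * z
        ≈⟨ solve 4 (λ x y z x′ → x :* z :+ (y :+ x′) :* z := y :* z :+ (x :+ x′) :* z) ≈-refl x y z (- x) ⟩
      y * z + (x + - x) * z   ≈⟨ +-congˡ (trans (*-congʳ (-‿inverseʳ x)) (zeroˡ z)) ⟩
      y * z + 0#              ≈⟨ +-identityʳ _ ⟩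
      y * z                   ∎

  -- A disjunction that admits case distinctions, unlike `_≤_`, which is a negation.
  NonNegative : Carrier → Set _
  NonNegative x = x ≈ 0# ⊎ 0# < x

  <-+-nonneg : ∀ {x y z} → x < y → NonNegative z → x < y + z
  <-+-nonneg x<y (inj₁ z≈0) = <-respʳ-≈ (sym (trans (+-congˡ z≈0) (+-identityʳ _))) x<y
  <-+-nonneg x<y (inj₂ 0<z) = <-trans x<y (<-respˡ-≈ (+-identityʳ _) (+-monoʳ-< _ 0<z))

  <-nonneg-+ : ∀ {x y z} → x < y → NonNegative z → x < z + y
  <-nonneg-+ x<y z≥0 = <-respʳ-≈ (+-comm _ _) (<-+-nonneg x<y z≥0)

  ·-nonneg : ∀ n {x} → 0# < x → NonNegative (n · x)
  ·-nonneg zero    0<x = inj₁ ≈-refl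
  ·-nonneg (suc n) 0<x = inj₂ (<-+-nonneg 0<x (·-nonneg n 0<x))

  <-·-mono : ∀ {m n x y} → 0# < y → m ≤ℕ n → x < m · y → x < n · y
  <-·-mono {m} {n} {x} {y} 0<y m≤n x<my with ℕ.m≤n⇒∃[o]m+o≡n m≤n
  ... | o , refl = <-respʳ-≈ (sym (×-homo-+ y m o)) (<-+-nonneg x<my (·-nonneg o 0<y))

  ⟨,⟩-nonneg : ∀ {n} (k : Vec ℕ n) t → (∀ i → 0# < t i) → NonNegative ⟨ k , t ⟩
  ⟨,⟩-nonneg []      t t>0 = inj₁ ≈-refl
  ⟨,⟩-nonneg (n ∷ k) t t>0 with ·-nonneg n (t>0 zero)
  ... | inj₁ nt≈0 = [ inj₁ ∘ trans (trans (+-congʳ nt≈0) (+-identityˡ _))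
                    , (λ 0<⟨⟩ → inj₂ (<-nonneg-+ 0<⟨⟩ (inj₁ nt≈0))) ]
                      (⟨,⟩-nonneg k (t ∘ suc) (t>0 ∘ suc))
  ... | inj₂ 0<nt = inj₂ (<-+-nonneg 0<nt (⟨,⟩-nonneg k (t ∘ suc) (t>0 ∘ suc)))

  <-⟨,⟩ : ∀ {n} (k : Vec ℕ n) t → (∀ i → 0# < t i) → ∀ i {x} → x < lookup k i · t i → x < ⟨ k , t ⟩
  <-⟨,⟩ (n ∷ k) t t>0 zero    x<kt = <-+-nonneg x<kt (⟨,⟩-nonneg k (t ∘ suc) (t>0 ∘ suc))
  <-⟨,⟩ (n ∷ k) t t>0 (suc i) x<kt =
    <-nonneg-+ (<-⟨,⟩ k (t ∘ suc) (t>0 ∘ suc) i x<kt) (·-nonneg n (t>0 zero))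

  -- The Archimedean property for `x * y⁻¹`, multiplied by `y`.
  archimedean-· : ∀ x {y} → 0# < y → ∃ λ n → x < n · y
  archimedean-· x {y} 0<y with #⇒invertible (Equivalence.from #⇔<⊎> (inj₂ 0<y))
  ... | y⁻¹ , y⁻¹y≈1 , _ with archimedean (x * y⁻¹)
  ... | n , xy⁻¹<n = n , <-respʳ-≈ (trans (×-assoc-* n 1# y) (×-congʳ n (*-identityˡ y)))
                           (<-respˡ-≈ x-recovered (*-monoˡ-< 0<y xy⁻¹<n))
    where
    x-recovered : x * y⁻¹ * y ≈ x
    x-recovered = begin
      x * y⁻¹ * y            ≈⟨ *-assoc x y⁻¹ y ⟩
      -- The field axiom provides an inverse of the difference `y + - 0#`.
      x * (y⁻¹ * y)          ≈⟨ *-congˡ (*-congˡ (trans (+-congˡ -0≈0) (+-identityʳ y))) ⟨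
      x * (y⁻¹ * (y + - 0#)) ≈⟨ *-congˡ y⁻¹y≈1 ⟩
      x * 1#                 ≈⟨ *-identityʳ x ⟩
      x                      ∎
      where
      -0≈0 : - 0# ≈ 0#
      -0≈0 = trans (sym (+-identityˡ _)) (-‿inverseʳ 0#)

  -- Tail sums and pairings for travel times

  ½+½ : ½ + ½ ≈ 1#
  ½+½ = begin
    ½ + ½                 ≈⟨ solve 1 (λ h → h :+ h := h :* ((con 1 :+ con 1) :+ con 0)) ≈-refl ½ ⟩
    ½ * (2# + 0#)         ≈⟨ *-congˡ (+-congˡ (trans (sym (+-identityʳ _)) (-‿inverseˡ 0#))) ⟨
    ½ * (2# + - 0#)       ≈⟨ proj₁ (proj₂ (#⇒invertible 2#0)) ⟩
    1#                    ∎

  -- For `τ′` and a depth, half of this is the time of direct descent from there to the receiver.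
  ∑from : ∀ {n} → Vector Carrier n → Fin (suc n) → Carrier
  ∑from             t zero    = ∑ t
  ∑from {n = suc _} t (suc i) = ∑from (t ∘ suc) i

  ∑from-inject₁ : ∀ {n} (t : Vector Carrier n) j → ∑from t (inject₁ j) ≡ t j + ∑from t (suc j)
  ∑from-inject₁ t zero    = refl
  ∑from-inject₁ t (suc j) = ∑from-inject₁ (t ∘ suc) j

  ∑from-fromℕ : ∀ {n} (t : Vector Carrier n) → ∑from t (fromℕ n) ≡ 0#
  ∑from-fromℕ {zero}  t = refl
  ∑from-fromℕ {suc n} t = ∑from-fromℕ (t ∘ suc)

  ⟨0,⟩ : ∀ {n} (t : Vector Carrier n) → ⟨ replicate n 0 , t ⟩ ≈ 0#
  ⟨0,⟩ {zero}  t = ≈-refl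
  ⟨0,⟩ {suc n} t = trans (+-identityˡ _) (⟨0,⟩ (t ∘ suc))

  ⟨updateAt-suc,⟩ : ∀ {n} (k : Vec ℕ n) j t → ⟨ updateAt k j suc , t ⟩ ≈ t j + ⟨ k , t ⟩
  ⟨updateAt-suc,⟩ (x ∷ k) zero    t = +-assoc _ _ _
  ⟨updateAt-suc,⟩ (x ∷ k) (suc j) t = begin
    x · t zero + ⟨ updateAt k j suc , t ∘ suc ⟩
      ≈⟨ +-congˡ (⟨updateAt-suc,⟩ k j (t ∘ suc)) ⟩
    x · t zero + (t (suc j) + ⟨ k , t ∘ suc ⟩)
      ≈⟨ solve 3 (λ a b c → a :+ (b :+ c) := b :+ (a :+ c)) ≈-refl _ _ _ ⟩
    t (suc j) + (x · t zero + ⟨ k , t ∘ suc ⟩)      ∎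

  -- Weights and arrival times of walks in a medium

  module _ {M : ℕ} (μ : Medium M) where
    open Medium μ

    interface : Fin (suc M) → Weights
    interface n = weights (R n) (T n)

    sideOf : Fin (suc M) → Side → Depth M
    sideOf n ⇑ = above n
    sideOf n ⇓ = below n

    next≡first : ∀ q → next μ q ≡ first q
    next≡first []      = refl
    next≡first (_ ∷ _) = refl

    factor-sideOf : ∀ n s s′ → factor μ (sideOf n s) n (sideOf n s′) ≡ interface n s s′
    factor-sideOf n ⇑ ⇑ with above n Fin.≟ above n
    ... | yes _  = refl
    ... | no a≢a = contradiction refl a≢a
    factor-sideOf n ⇓ ⇓ with below n Fin.≟ above n | below n Fin.≟ below n
    ... | yes b≡a | _      = contradiction (≡.sym b≡a) inject₁²≢suc²
    ... | no _    | yes _  = refl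
    ... | no _    | no b≢b = contradiction refl b≢b
    factor-sideOf n ⇑ ⇓ with above n Fin.≟ above n | below n Fin.≟ above n | above n Fin.≟ below n
    ... | _       | yes b≡a | _       = contradiction (≡.sym b≡a) inject₁²≢suc²
    ... | _       | _       | yes a≡b = contradiction a≡b inject₁²≢suc²
    ... | yes _   | no _    | no _    = refl
    ... | no _    | no _    | no _    = refl
    factor-sideOf n ⇓ ⇑ with below n Fin.≟ above n | above n Fin.≟ below n | below n Fin.≟ below n
    ... | yes b≡a | _       | _       = contradiction (≡.sym b≡a) inject₁²≢suc²
    ... | _       | yes a≡b | _       = contradiction a≡b inject₁²≢suc²
    ... | no _    | no _    | yes _   = refl
    ... | no _    | no _    | no _    = refl

    -- The hypothesis ties the previous depth `a` to the side `s` only when z_p is an interface; at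
    -- the receiver it is vacuous.
    weightFrom-interior : ∀ {p} (w : Walk p) {a} s → (∀ n → p ≡ inject₁ n → a ≡ sideOf n s) →
      weightFrom μ a (interior w) ≈ walkWeight interface s w
    weightFrom-interior (arrived _) s a≡ = ≈-refl
    weightFrom-interior (up j refl w) s a≡
      rewrite next≡first (interior w) | first-interior w | a≡ (suc j) refl =
      *-cong (reflexive (factor-sideOf (suc j) s ⇑))
        (weightFrom-interior w ⇓ λ n eq → ≡.cong below (Fin.inject₁-injective eq))
    weightFrom-interior (down j refl w) s a≡
      rewrite next≡first (interior w) | first-interior w | a≡ j refl =
      *-cong (reflexive (factor-sideOf j s ⇓))
        (weightFrom-interior w ⇑ λ n eq → ≡.cong inject₁ eq)

    weight-sequence : ∀ w → weight μ (sequence w) ≈ walkWeight interface ⇑ w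
    weight-sequence w = weightFrom-interior w ⇑ λ { zero _ → refl }

    travelTime-prepend : ∀ {a} q (e : Adjacent a (first q)) es →
      travelTime μ (prepend q e es) ≡ ½ * τ′ (layer e) + travelTime μ es
    travelTime-prepend []      e es = refl
    travelTime-prepend (_ ∷ _) e es = refl

    -- An ascent costs half of `t` and lengthens the remaining direct descent by the other half; a
    -- descent uses up its own share of the tail sum.
    travelTime-path : ∀ {p} (w : Walk p) →
      travelTime μ (path w) ≈ ½ * ∑from τ′ (suc p) + ⟨ 0 ∷ ascents w , τ ⟩
    travelTime-path (arrived refl) = sym (begin
      ½ * ∑from τ′ (fromℕ (2 ℕ.+ M)) + ⟨ replicate (suc M) 0 , τ ⟩
        ≈⟨ +-cong (*-congˡ (reflexive (∑from-fromℕ τ′))) (⟨0,⟩ τ) ⟩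
      ½ * 0# + 0#  ≈⟨ trans (+-identityʳ _) (zeroʳ ½) ⟩
      0#           ∎)
    travelTime-path (up j refl w) = begin
      travelTime μ (path (up j refl w))
        ≡⟨ travelTime-prepend (interior w) _ (path w) ⟩
      ½ * t + travelTime μ (path w)
        ≈⟨ +-congˡ (travelTime-path w) ⟩
      ½ * t + (½ * ∑from τ′ (inject₁ (suc (inject₁ j))) + K)
        ≈⟨ +-congˡ (+-congʳ (*-congˡ (reflexive (∑from-inject₁ τ′ (suc (inject₁ j)))))) ⟩
      ½ * t + (½ * (t + S) + K)
        ≈⟨ solve 4 (λ h t S K → h :* t :+ (h :* (t :+ S) :+ K) := h :* S :+ ((h :+ h) :* t :+ K)) ≈-refl ½ t S K ⟩
      ½ * S + ((½ + ½) * t + K)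
        ≈⟨ +-congˡ (+-congʳ (trans (*-congʳ ½+½) (*-identityˡ t))) ⟩
      ½ * S + (t + K)
        ≈⟨ +-congˡ (⟨updateAt-suc,⟩ (0 ∷ ascents w) (suc j) τ) ⟨
      ½ * S + ⟨ 0 ∷ updateAt (ascents w) j suc , τ ⟩ ∎
      where
      t = τ (suc j)
      S = ∑from τ′ (suc (inject₁ (suc j)))
      K = ⟨ 0 ∷ ascents w , τ ⟩
    travelTime-path (down j refl w) = begin
      travelTime μ (path (down j refl w))
        ≡⟨ travelTime-prepend (interior w) _ (path w) ⟩
      ½ * t + travelTime μ (path w)
        ≈⟨ +-congˡ (travelTime-path w) ⟩
      ½ * t + (½ * S + K)
        ≈⟨ solve 4 (λ h t S K → h :* t :+ (h :* S :+ K) := h :* (t :+ S) :+ K) ≈-refl ½ t S K ⟩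
      ½ * (t + S) + K
        ≈⟨ +-congʳ (*-congˡ (reflexive (∑from-inject₁ τ′ (suc j)))) ⟨
      ½ * ∑from τ′ (suc (inject₁ j)) + K ∎
      where
      t = τ′ (suc j)
      S = ∑from τ′ (suc (suc j))
      K = ⟨ 0 ∷ ascents w , τ ⟩

    time : Vec ℕ M → Carrier
    time k = ½ * ∑ τ′ + ⟨ 0 ∷ k , τ ⟩

    arrival-sequence : ∀ w → arrival μ (sequence w) ≈ time (ascents w)
    arrival-sequence w = begin
      travelTime μ (prepend (interior w) _ (path w))
        ≡⟨ travelTime-prepend (interior w) _ (path w) ⟩
      ½ * τ′ zero + travelTime μ (path w)
        ≈⟨ +-congˡ (travelTime-path w) ⟩
      ½ * τ′ zero + (½ * ∑ (τ′ ∘ suc) + ⟨ 0 ∷ ascents w , τ ⟩)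
        ≈⟨ solve 4 (λ h t S K → h :* t :+ (h :* S :+ K) := h :* (t :+ S) :+ K) ≈-refl _ _ _ _ ⟩
      time (ascents w) ∎

  -- Total weight for given ascents

  module _ {M : ℕ} where

    walksTo : (k : Vec ℕ M) → Walks zero k
    walksTo k = walks (suc (2 ℕ.* sum k ℕ.+ suc M)) zero k (ℕ.≤-reflexive (≡.sym (ℕ.+-identityʳ _)))

    total-walksTo : ∀ (μ : Medium M) k → let open Medium μ in
      ∑ˡ (elements (enumeration (walksTo k))) (weight μ ∘ sequence) ≈ b R (0 ∷ k)
    total-walksTo μ k = begin
      ∑ˡ (elements (enumeration (walksTo k))) (weight μ ∘ sequence)
        ≈⟨ ∑ˡ-cong (elements (enumeration (walksTo k))) (weight-sequence μ) ⟩
      ∑ˡ (elements (enumeration (walksTo k))) (walkWeight (interface μ) ⇑)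
        ≈⟨ total (walksTo k) (interface μ) ⇑ ⟩
      layered (interface μ) zero ⇑ 0 k
        ≈⟨ layered-start (Medium.R μ) 0 k ⟩
      b (Medium.R μ) (0 ∷ k) ∎

  -- Pairing with a test function

  module _ {M : ℕ} (μ : Medium M) (ψ : TestFunction) where
    open Medium μ
    open TestFunction ψ

    -- That many ascents through a single layer already delay the arrival past `upper`.
    latest : ∀ j → ∃ λ n → upper + - (½ * ∑ τ′) < n · τ (suc j)
    latest j = archimedean-· _ (τ′>0 (inject₁ (suc j)))

    latestᵛ : Vec ℕ M
    latestᵛ = Vec.tabulate (proj₁ ∘ latest)

    -- The other terms of the pairing with `τ` are nonnegative, so one large entry suffices.
    late : ∀ k j → lookup latestᵛ j ℕ.< lookup k j → upper < time μ k
    late k j n<kⱼ = <-respˡ-≈ upper-recovered (+-monoʳ-< (½ * ∑ τ′)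
      (<-⟨,⟩ (0 ∷ k) τ (τ′>0 ∘ inject₁) (suc j)
        (<-·-mono (τ′>0 (inject₁ (suc j)))
          (ℕ.≤-trans (ℕ.≤-reflexive (≡.sym (Vec.lookup∘tabulate (proj₁ ∘ latest) j))) (ℕ.<⇒≤ n<kⱼ))
          (proj₂ (latest j)))))
      where
      upper-recovered : ½ * ∑ τ′ + (upper + - (½ * ∑ τ′)) ≈ upper
      upper-recovered = begin
        ½ * ∑ τ′ + (upper + - (½ * ∑ τ′))
          ≈⟨ solve 3 (λ x u x′ → x :+ (u :+ x′) := u :+ (x :+ x′)) ≈-refl _ _ _ ⟩
        upper + (½ * ∑ τ′ + - (½ * ∑ τ′))  ≈⟨ +-congˡ (-‿inverseʳ _) ⟩
        upper + 0#                         ≈⟨ +-identityʳ upper ⟩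
        upper                              ∎

    early⊎vanishes : ∀ k → k ∈ box latestᵛ ⊎ φ (time μ k) ≈ 0#
    early⊎vanishes k with ∈-box⊎exceeds latestᵛ k
    ... | inj₁ k∈         = inj₁ k∈
    ... | inj₂ (j , n<kⱼ) = inj₂ (bounded (time μ k) (inj₂ (late k j n<kⱼ)))

    earlyWalks : Enumeration (λ w → ascents w ∈ box latestᵛ)
    earlyWalks = fibres ascents (λ k → enumeration (walksTo k)) (box-unique latestᵛ)

    pairing : Carrier
    pairing = ∑ˡ (box latestᵛ) (λ k → b R (0 ∷ k) * φ (time μ k))

    pairing-coefficients : impulses (Vec ℕ M) (λ k → b R (0 ∷ k)) (time μ) ⟨ ψ ⟩≔ pairing
    pairing-coefficients = record
      { support  = box latestᵛ
      ; unique   = box-unique latestᵛ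
      ; vanishes = vanish
      ; total    = ≈-refl
      }
      where
      vanish : ∀ k → k ∉ box latestᵛ → b R (0 ∷ k) * φ (time μ k) ≈ 0#
      vanish k k∉ with early⊎vanishes k
      ... | inj₁ k∈  = contradiction k∈ k∉
      ... | inj₂ φ≈0 = trans (*-congˡ φ≈0) (zeroʳ _)

    -- Sequences are grouped by ascents. The arrival time is constant on each group, so the value of
    -- `φ` factors out and the remaining weights add up to the coefficient.
    pairing-H : H μ ⟨ ψ ⟩≔ pairing
    pairing-H = record
      { support  = List.map sequence (elements earlyWalks)
      ; unique   = Unique.map⁺ sequence-injective (unique earlyWalks)
      ; vanishes = vanish
      ; total    = begin
          ∑ˡ (List.map sequence (elements earlyWalks)) f
            ≡⟨ ∑ˡ-map sequence (elements earlyWalks) f ⟩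
          ∑ˡ (elements earlyWalks) (f ∘ sequence)
            ≈⟨ ∑ˡ-fibres ascents (λ k → enumeration (walksTo k)) (box-unique latestᵛ) (f ∘ sequence) ⟩
          ∑ˡ (box latestᵛ) (λ k → ∑ˡ (elements (enumeration (walksTo k))) (f ∘ sequence))
            ≈⟨ ∑ˡ-cong (box latestᵛ) total-fibre ⟩
          pairing ∎
      }
      where
      f : TransmissionSequence M → Carrier
      f i = weight μ i * φ (arrival μ i)

      vanish : ∀ i → i ∉ List.map sequence (elements earlyWalks) → f i ≈ 0#
      vanish i i∉ with sequence-surjective i
      ... | w , refl with early⊎vanishes (ascents w)
      ... | inj₁ k∈  = contradiction (∈-map⁺ sequence (complete earlyWalks k∈)) i∉
      ... | inj₂ φ≈0 = trans (*-congˡ (trans (φ-cong (arrival-sequence μ w)) φ≈0)) (zeroʳ _)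

      total-fibre : ∀ k → ∑ˡ (elements (enumeration (walksTo k))) (f ∘ sequence) ≈ b R (0 ∷ k) * φ (time μ k)
      total-fibre k = begin
        ∑ˡ ws (f ∘ sequence)
          -- Membership in the fibre identifies the arrival time with `time μ k`.
          ≈⟨ ∑ˡ-cong-∈ ws (λ {w} w∈ → trans (*-comm _ _) (*-congʳ (φ-cong (trans (arrival-sequence μ w)
               (reflexive (≡.cong (time μ) (sound (enumeration (walksTo k)) w∈))))))) ⟩
        ∑ˡ ws (λ w → φ (time μ k) * weight μ (sequence w))
          ≈⟨ *-∑ˡ (φ (time μ k)) ws (weight μ ∘ sequence) ⟨
        φ (time μ k) * ∑ˡ ws (weight μ ∘ sequence)
          ≈⟨ trans (*-comm _ _) (*-congʳ (total-walksTo μ k)) ⟩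
        b R (0 ∷ k) * φ (time μ k) ∎
        where ws = elements (enumeration (walksTo k))

theorem2 :
    ∀ {c ℓ₁ ℓ₂} (ℝ : RealField c ℓ₁ ℓ₂) →
    let open RealField ℝ
        open Scattering ℝ
    in (M : ℕ) → 1 ≤ℕ M → (μ : Medium M) →
    let open Medium μ
    in H μ ≐ impulses (Vec ℕ M)
               (λ ks → b R (0 ∷ ks))
               (λ ks → ½ * ∑ τ′ + ⟨ 0 ∷ ks , τ ⟩)
theorem2 ℝ M _ μ ψ = pairing ℝ μ ψ , pairing-H ℝ μ ψ , pairing-coefficients ℝ μ ψ
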